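{- For every $k\in\{1,2,3,\dots\}\cup\{\infty\}$, the class $\mathcal{U}^k_{MDS}$ is exactly the class of connected sputnik graphs. That is, for a finite connected simple graph $G$, every minimal dominating set of $G$ is $k$-robust if and only if $G$ is a sputnik graph.
   Context: Graphs are finite, simple, undirected and connected. A dominating set of a graph is a set $D$ of vertices such that every vertex is in $D$ or has a neighbor in $D$. A minimal dominating set (MDS) is a dominating set that is minimal under inclusion. An MDS $D$ of $G=(V,E)$ is $k$-robust if for every set $F\subseteq E$ of at most $k$ edges, either the graph $G-F=(V,E\setminus F)$ is disconnected, or $D$ is still a minimal dominating set of $G-F$. For $k=\infty$ there is no bound on $|F|$. $\mathcal{U}^k_{MDS}$ is the class of graphs $G$ such that every minimal dominating set of $G$ is $k$-robust. A sputnik graph is a graph in which every vertex that belongs to a cycle has an antenna, i.e. a neighbor of degree $1$. -}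

module Defs where

open import Data.Fin.Base using (Fin; _<_)
open import Data.Fin.Properties using (_<?_)
open import Data.Fin.Subset using (Subset; _∈_; _∉_; _⊆_; _⊂_; _─_; ∣_∣)
open import Data.Fin.Subset.Properties
  using (_∈?_; p─q⊆p; x∈p∧x∉q⇒x∈p─q)
open import Data.List.Base
  using (List; _∷_; _∷ʳ_; length; filter; cartesianProduct; allFin)
import Data.List.Membership.Propositional as List
open import Data.List.Relation.Unary.Linked using (Linked)
open import Data.List.Relation.Unary.Unique.Propositional using (Unique)
open import Data.Nat.Base as ℕ using (ℕ)
open import Data.Product.Base using (_×_; _,_; ∃-syntax)
open import Data.Sum.Base using (_⊎_)
open import Data.Vec.Base using (_∷_; here; there)
open import Level using (0ℓ)
open import Relation.Binary.Construct.Add.Supremum.NonStrict ℕ._≤_ public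
  using (_≤⁺_)
open import Relation.Binary.Construct.Closure.ReflexiveTransitive using (Star)
open import Relation.Binary.Core using (Rel)
open import Relation.Binary.PropositionalEquality.Core using (_≡_)
open import Relation.Nullary.Construct.Add.Supremum public using (_⁺; [_]; ⊤⁺)
open import Relation.Nullary.Decidable using (_×-dec_)
open import Relation.Nullary.Negation using (¬_)

private
  variable
    n : ℕ

------------------------------------------------------------------------
-- Finite simple graphs

-- A graph on the vertex set Fin n, given by the neighbourhood of each vertex.
record Graph (n : ℕ) : Set where
  field
    N      : Fin n → Subset n
    sym    : ∀ {u v} → v ∈ N u → u ∈ N v
    irrefl : ∀ {v} → v ∉ N v

  Adj : Rel (Fin n) 0ℓ
  Adj u v = v ∈ N u

  degree : Fin n → ℕ
  degree v = ∣ N v ∣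

  -- Each edge {u , v} is listed once, as the pair (u , v) with u < v.
  edges : List (Fin n × Fin n)
  edges = filter (λ (u , v) → (u <? v) ×-dec (v ∈? N u))
                 (cartesianProduct (allFin n) (allFin n))

  -- For n ≡ 0 this holds vacuously.
  Connected : Set
  Connected = ∀ u v → Star Adj u v

open Graph public using (N; Adj; degree; edges; Connected)

-- A set of edges on Fin n is the same thing as a graph on Fin n.
EdgeSet : ℕ → Set
EdgeSet = Graph

_⊆ᴱ_ : EdgeSet n → Graph n → Set
F ⊆ᴱ G = ∀ u → N F u ⊆ N G u

x∈p─q⇒x∉q : ∀ {x : Fin n} (p q : Subset n) → x ∈ p ─ q → x ∉ q
x∈p─q⇒x∉q (_ ∷ p) (_ ∷ q) (there x∈) (there x∈q) = x∈p─q⇒x∉q p q x∈ x∈q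

_-ᴱ_ : Graph n → EdgeSet n → Graph n
G -ᴱ F = record
  { N      = λ u → N G u ─ N F u
  ; sym    = λ {u} {v} v∈ → x∈p∧x∉q⇒x∈p─q
      (Graph.sym G (p─q⊆p (N G u) (N F u) v∈))
      (λ u∈F → x∈p─q⇒x∉q (N G u) (N F u) v∈ (Graph.sym F u∈F))
  ; irrefl = λ {v} v∈ → Graph.irrefl G (p─q⊆p (N G v) (N F v) v∈)
  }

------------------------------------------------------------------------
-- Dominating sets

Dominating : Graph n → Subset n → Set
Dominating G D = ∀ v → v ∈ D ⊎ ∃[ u ] u ∈ D × Adj G v u

MDS : Graph n → Subset n → Set
MDS G D = Dominating G D × (∀ {D′} → D′ ⊂ D → ¬ Dominating G D′)

------------------------------------------------------------------------
-- Robustness; k ranges over ℕ ∪ {∞} and ⊤⁺ plays the role of ∞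

Robust : ℕ ⁺ → Graph n → Subset n → Set
Robust k G D = ∀ F → F ⊆ᴱ G → [ length (edges F) ] ≤⁺ k →
               ¬ Connected (G -ᴱ F) ⊎ MDS (G -ᴱ F) D

𝓤-MDS : ℕ ⁺ → Graph n → Set
𝓤-MDS k G = Connected G × (∀ D → MDS G D → Robust k G D)

------------------------------------------------------------------------
-- Sputnik graphs

data IsCycle (G : Graph n) : List (Fin n) → Set where
  cycle : ∀ {v vs} → 3 ℕ.≤ length (v ∷ vs) → Unique (v ∷ vs) →
          Linked (Adj G) (v ∷ vs ∷ʳ v) → IsCycle G (v ∷ vs)

OnCycle : Graph n → Fin n → Set
OnCycle G v = ∃[ c ] IsCycle G c × v List.∈ c

HasAntenna : Graph n → Fin n → Set
HasAntenna G v = ∃[ a ] Adj G v a × degree G a ≡ 1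

Sputnik : Graph n → Set
Sputnik G = ∀ v → OnCycle G v → HasAntenna G v

{-# OPTIONS --safe #-}
-- Deleting edges never makes a smaller set dominating, so a minimal dominating
-- set can only fail in G - F by ceasing to dominate.
--
-- If G is sputnik and G - F is connected, both ends of a deleted edge lie on a
-- cycle, hence have antennas; an antenna keeps its edge, and since D meets
-- {v , antenna of v}, the vertex v stays dominated.
--
-- Conversely, suppose that deleting the edge ab does not disconnect G and that
-- V ∖ (N[a] ∖ {b}) is dominating. A minimal dominating set inside it meets N[a]
-- exactly in b, so it no longer dominates a once ab is deleted. If v lies on a
-- cycle and has no antenna, such an edge exists. Let u follow v on the cycle;
-- vu is a candidate. It can only fail because of some w with N[w] ⊆ N[v];
-- as w has a second neighbour, w and v lie on a triangle, and then wv works.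
module Submission where

open import Data.Empty using (⊥-elim)
open import Data.Fin.Base using (Fin; _<_)
open import Data.Fin.Properties using (_≟_; _<?_; any?; all?; <-asym)
open import Data.Fin.Subset using (Subset; _∈_; _∉_; _⊆_; _⊂_; ∣_∣; ⁅_⁆)
open import Data.Fin.Subset.Induction using (⊂-wellFounded; Acc; acc)
open import Data.Fin.Subset.Properties
  using (_∈?_; _⊂?_; anySubset?; p─q⊆p; x∈p∧x∉q⇒x∈p─q; x∈⁅x⁆; x∈⁅y⁆⇒x≡y; ∣⁅x⁆∣≡1;
         ⊆-refl; ⊆-trans; ⊆-antisym; p⊂q⇒p⊆q; p⊂q⇒∣p∣<∣q∣)
open import Data.List.Base
  using (List; []; _∷_; _++_; _∷ʳ_; length; head; last; allFin; cartesianProduct)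
open import Data.List.Membership.Propositional using () renaming (_∈_ to _∈ₗ_)
import Data.List.Membership.DecPropositional as DecMembership
open import Data.List.Membership.Propositional.Properties using (∈-∃++; ∈-filter⁻)
open import Data.List.Properties using (++-assoc; ++-identityʳ; length-++-comm)
open import Data.List.Relation.Unary.All using (All; []; _∷_)
import Data.List.Relation.Unary.All as All
open import Data.List.Relation.Unary.All.Properties using (¬Any⇒All¬; All¬⇒¬Any)
open import Data.List.Relation.Unary.AllPairs using ([]; _∷_)
open import Data.List.Relation.Unary.Any using (here; there)
open import Data.List.Relation.Unary.Linked using (Linked; []; [-]; _∷_)
import Data.List.Relation.Unary.Linked as Linked
import Data.List.Relation.Unary.Linked.Properties as Linkedₚ
open import Data.List.Relation.Unary.Unique.Propositional using (Unique)
import Data.List.Relation.Unary.Unique.Propositional.Properties as Uniqueₚ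
open import Data.Maybe.Base using (just)
open import Data.Maybe.Relation.Binary.Connected as Maybe using (just)
open import Data.Nat.Base as ℕ using (ℕ; z≤n; s≤s)
import Data.Nat.Properties as ℕₚ
open import Data.Product.Base using (_×_; _,_; proj₁; proj₂; ∃-syntax)
open import Data.Sum.Base as Sum using (_⊎_; inj₁; inj₂)
open import Data.Vec.Base using (tabulate)
open import Data.Vec.Properties using (lookup∘tabulate; lookup⇒[]=; []=⇒lookup)
open import Defs
open import Function.Base using (_∘_; id)
open import Function.Bundles using (_⇔_; mk⇔)
open import Relation.Binary.Construct.Add.Supremum.NonStrict ℕ._≤_ using ([_]; ≤⁺-trans)
open import Relation.Binary.Construct.Closure.ReflexiveTransitive
  using (Star; ε; _◅_; reverse; kleisliStar)
open import Relation.Binary.Core using (Rel)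
open import Relation.Binary.PropositionalEquality
  using (_≡_; _≢_; refl; sym; trans; cong; subst)
open import Relation.Nullary.Decidable
  using (Dec; yes; no; does; decidable-stable; dec-true; ¬?; map′; _×-dec_; _⊎-dec_)
open import Relation.Nullary.Negation using (¬_; contradiction)
open import Relation.Unary using (Pred; Decidable)

private
  variable
    n : ℕ

-- Finite subsets and lists

module _ {ℓ} {P : Pred (Fin n) ℓ} (P? : Decidable P) where

  ⟪_⟫ : Subset n
  ⟪_⟫ = tabulate (does ∘ P?)

  ∈⟪⟫⁺ : ∀ {x} → P x → x ∈ ⟪_⟫
  ∈⟪⟫⁺ {x} p =
    lookup⇒[]= x _ (trans (lookup∘tabulate (does ∘ P?) x) (dec-true (P? x) p))

  ∈⟪⟫⁻ : ∀ {x} → x ∈ ⟪_⟫ → P x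
  ∈⟪⟫⁻ {x} x∈ with P? x | trans (sym (lookup∘tabulate (does ∘ P?) x)) ([]=⇒lookup x∈)
  ... | yes p | _ = p

∣p∣≡1⇒subsingleton : ∀ {p : Subset n} {x y} → ∣ p ∣ ≡ 1 → x ∈ p → y ∈ p → y ≡ x
∣p∣≡1⇒subsingleton {p = p} {x} {y} ∣p∣≡1 x∈p y∈p with y ≟ x
... | yes y≡x = y≡x
... | no  y≢x = contradiction (p⊂q⇒∣p∣<∣q∣ ⁅x⁆⊂p)
                  (ℕₚ.<-irrefl (trans (∣⁅x⁆∣≡1 x) (sym ∣p∣≡1)))
  where
  ⁅x⁆⊂p : ⁅ x ⁆ ⊂ p
  ⁅x⁆⊂p = (λ z∈ → subst (_∈ p) (sym (x∈⁅y⁆⇒x≡y x z∈)) x∈p) ,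
          y , y∈p , y≢x ∘ x∈⁅y⁆⇒x≡y x

subsingleton⇒∣p∣≡1 : ∀ {p : Subset n} {x} → x ∈ p → (∀ {y} → y ∈ p → y ≡ x) → ∣ p ∣ ≡ 1
subsingleton⇒∣p∣≡1 {p = p} {x} x∈p unique = trans (cong ∣_∣ p≡⁅x⁆) (∣⁅x⁆∣≡1 x)
  where
  p≡⁅x⁆ : p ≡ ⁅ x ⁆
  p≡⁅x⁆ = ⊆-antisym (λ y∈p → subst (_∈ ⁅ x ⁆) (sym (unique y∈p)) (x∈⁅x⁆ x))
                    (λ y∈ → subst (_∈ p) (sym (x∈⁅y⁆⇒x≡y x y∈)) x∈p)

module _ {a} {A : Set a} where

  Unique-constant⇒length≤1 : ∀ {xs : List A} → Unique xs →
    (∀ {x y} → x ∈ₗ xs → y ∈ₗ xs → x ≡ y) → length xs ℕ.≤ 1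
  Unique-constant⇒length≤1 {[]}        _               _     = z≤n
  Unique-constant⇒length≤1 {_ ∷ []}    _               _     = s≤s z≤n
  Unique-constant⇒length≤1 {_ ∷ _ ∷ _} ((x≢y ∷ _) ∷ _) const =
    contradiction (const (here refl) (there (here refl))) x≢y

  Linked-∷ʳ⁺ : ∀ {ℓ} {R : Rel A ℓ} xs {x y} →
               Linked R (xs ∷ʳ x) → R x y → Linked R (xs ∷ʳ x ∷ʳ y)
  Linked-∷ʳ⁺ []           _            Rxy = Rxy ∷ [-]
  Linked-∷ʳ⁺ (_ ∷ [])     (Rzx ∷ Rxs)  Rxy = Rzx ∷ Linked-∷ʳ⁺ [] Rxs Rxy
  Linked-∷ʳ⁺ (_ ∷ w ∷ xs) (Rzw ∷ Rxs)  Rxy = Rzw ∷ Linked-∷ʳ⁺ (w ∷ xs) Rxs Rxy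

-- Walks and cycles

SimplePath : ∀ {ℓ} → Rel (Fin n) ℓ → Fin n → Fin n → List (Fin n) → Set ℓ
SimplePath R x y vs = Linked R vs × Unique vs × head vs ≡ just x × last vs ≡ just y

module _ {ℓ} {R : Rel (Fin n) ℓ} where

  open DecMembership (_≟_ {n}) using () renaming (_∈?_ to _∈ₗ?_)

  SimplePath-suffix : ∀ {x y z vs} → SimplePath R x y vs → z ∈ₗ vs →
                      ∃[ ws ] SimplePath R z y ws
  SimplePath-suffix (l , u , _ , lst) (here refl) = _ , l , u , refl , lst
  SimplePath-suffix {vs = _ ∷ _ ∷ _} (_ ∷ l , _ ∷ u , _ , lst) (there z∈) =
    SimplePath-suffix (l , u , refl , lst) z∈

  -- Loop erasure: if the start already occurs on the simple path built from the tail, everything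
  -- before that occurrence is dropped instead of prepending a repetition.
  Star⇒SimplePath : ∀ {x y} → Star R x y → ∃[ vs ] SimplePath R x y vs
  Star⇒SimplePath {x} ε = x ∷ [] , [-] , [] ∷ [] , refl , refl
  Star⇒SimplePath {x} (Rxz ◅ path) with Star⇒SimplePath path
  ... | vs@(_ ∷ _) , simple@(l , u , refl , lst) with x ∈ₗ? vs
  ...   | yes x∈vs = SimplePath-suffix simple x∈vs
  ...   | no  x∉vs = x ∷ vs , Rxz ∷ l , ¬Any⇒All¬ vs x∉vs ∷ u , refl , lst

module _ {G : Graph n} where

  IsCycle-rotate₁ : ∀ {v vs} → IsCycle G (v ∷ vs) → IsCycle G (vs ∷ʳ v)
  IsCycle-rotate₁ {vs = []} (cycle (s≤s ()) _ _)
  IsCycle-rotate₁ {v} {w ∷ ws} (cycle 3≤ (v∉ ∷ unique) (Gvw ∷ linked)) = cycle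
    (subst (3 ℕ.≤_) (length-++-comm (v ∷ []) (w ∷ ws)) 3≤)
    (Uniqueₚ.++⁺ unique ([] ∷ []) λ { (x∈ , here refl) → All¬⇒¬Any v∉ x∈ })
    (Linked-∷ʳ⁺ (w ∷ ws) linked Gvw)

  IsCycle-rotate : ∀ us {vs} → IsCycle G (us ++ vs) → IsCycle G (vs ++ us)
  IsCycle-rotate []       {vs} c = subst (IsCycle G) (sym (++-identityʳ vs)) c
  IsCycle-rotate (u ∷ us) {vs} c = subst (IsCycle G) (++-assoc vs (u ∷ []) us)
    (IsCycle-rotate us (subst (IsCycle G) (++-assoc us vs (u ∷ [])) (IsCycle-rotate₁ c)))

  -- Cut the cycle at `v` and move the part before `v` to the end, so that `v` and the vertex after
  -- it can be matched on.
  OnCycle⇒IsCycle-∷ : ∀ {v} → OnCycle G v → ∃[ vs ] IsCycle G (v ∷ vs)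
  OnCycle⇒IsCycle-∷ (c , isCycle , v∈c) with us , vs , refl ← ∈-∃++ v∈c =
    vs ++ us , IsCycle-rotate us isCycle

-- Deleting edges

-ᴱ-⊆ : ∀ {G : Graph n} F {u v} → Adj (G -ᴱ F) u v → Adj G u v
-ᴱ-⊆ {G = G} F {u} = p─q⊆p (N G u) (N F u)

-ᴱ-∉ : ∀ {G : Graph n} F {u v} → Adj (G -ᴱ F) u v → ¬ Adj F u v
-ᴱ-∉ {G = G} F {u} = x∈p─q⇒x∉q (N G u) (N F u)

-- A simple path from `u` to `v` in `G -ᴱ F` is closed to a cycle of `G` by the deleted edge `vu`.
-- It has at least three vertices: one would make `uv` a loop, and two would make the path the
-- deleted edge itself.
deletedEdge⇒OnCycle : ∀ {G F : Graph n} → F ⊆ᴱ G → Connected (G -ᴱ F) →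
                      ∀ {u v} → Adj F u v → OnCycle G u
deletedEdge⇒OnCycle {G = G} {F} F⊆G connected {u} {v} Fuv
  with Star⇒SimplePath (connected u v)
... | _ ∷ []        , _         , _      , refl , refl =
      contradiction Fuv (Graph.irrefl F)
... | _ ∷ _ ∷ []    , H ∷ _     , _      , refl , refl =
      contradiction Fuv (-ᴱ-∉ {G = G} F H)
... | vs@(_ ∷ _ ∷ _ ∷ _) , linked , unique , refl , lst =
      vs , cycle (s≤s (s≤s (s≤s z≤n))) unique closed , here refl
  where
  closed : Linked (Adj G) (vs ∷ʳ u)
  closed = Linkedₚ.++⁺ (Linked.map (-ᴱ-⊆ {G = G} F) linked)
             (subst (λ m → Maybe.Connected (Adj G) m (just u)) (sym lst)
               (just (Graph.sym G (F⊆G u Fuv))))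
             [-]

EndPoints : Fin n → Fin n → Rel (Fin n) _
EndPoints a b u v = (u ≡ a × v ≡ b) ⊎ (u ≡ b × v ≡ a)

endPoints? : ∀ (a b u v : Fin n) → Dec (EndPoints a b u v)
endPoints? a b u v = (u ≟ a ×-dec v ≟ b) ⊎-dec (u ≟ b ×-dec v ≟ a)

module _ (a b : Fin n) (a≢b : a ≢ b) where

  singleEdge : EdgeSet n
  singleEdge = record
    { N      = λ u → ⟪ endPoints? a b u ⟫
    ; sym    = λ {u} {v} v∈ → ∈⟪⟫⁺ (endPoints? a b v) (swap (∈⟪⟫⁻ (endPoints? a b u) v∈))
    ; irrefl = λ {v} v∈ → loop (∈⟪⟫⁻ (endPoints? a b v) v∈)
    }
    where
    swap : ∀ {u v} → EndPoints a b u v → EndPoints a b v u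
    swap (inj₁ (p , q)) = inj₂ (q , p)
    swap (inj₂ (p , q)) = inj₁ (q , p)
    loop : ∀ {v} → ¬ EndPoints a b v v
    loop (inj₁ (p , q)) = a≢b (trans (sym p) q)
    loop (inj₂ (p , q)) = a≢b (trans (sym q) p)

  singleEdge⁻ : ∀ {u v} → Adj singleEdge u v → EndPoints a b u v
  singleEdge⁻ {u} = ∈⟪⟫⁻ (endPoints? a b u)

  singleEdge⁺ : Adj singleEdge a b
  singleEdge⁺ = ∈⟪⟫⁺ (endPoints? a b a) (inj₁ (refl , refl))

  -- Of the two orientations of `ab` only the increasing one passes the filter in `edges`, so any
  -- two listed pairs coincide. This puts the deletion of one edge within every bound `k` that is at
  -- least 1.
  length-edges-singleEdge : length (edges singleEdge) ℕ.≤ 1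
  length-edges-singleEdge = Unique-constant⇒length≤1
    (Uniqueₚ.filter⁺ oriented? (Uniqueₚ.cartesianProduct⁺ (Uniqueₚ.allFin⁺ n) (Uniqueₚ.allFin⁺ n)))
    λ e∈ f∈ → same (proj₂ (∈-filter⁻ oriented? {xs = pairs} e∈))
                   (proj₂ (∈-filter⁻ oriented? {xs = pairs} f∈))
    where
    pairs = cartesianProduct (allFin n) (allFin n)

    Oriented : Pred (Fin n × Fin n) _
    Oriented (u , v) = u < v × Adj singleEdge u v

    oriented? : Decidable Oriented
    oriented? (u , v) = (u <? v) ×-dec (v ∈? N singleEdge u)

    same : ∀ {e f} → Oriented e → Oriented f → e ≡ f
    same {u , _} {x , _} (u<v , Euv) (x<y , Exy) with singleEdge⁻ {u} Euv | singleEdge⁻ {x} Exy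
    ... | inj₁ (refl , refl) | inj₁ (refl , refl) = refl
    ... | inj₁ (refl , refl) | inj₂ (refl , refl) = contradiction x<y (<-asym u<v)
    ... | inj₂ (refl , refl) | inj₁ (refl , refl) = contradiction x<y (<-asym u<v)
    ... | inj₂ (refl , refl) | inj₂ (refl , refl) = refl

  module _ (G : Graph n) where

    singleEdge-⊆ᴱ : Adj G a b → singleEdge ⊆ᴱ G
    singleEdge-⊆ᴱ Gab u v∈ with singleEdge⁻ {u} v∈
    ... | inj₁ (refl , refl) = Gab
    ... | inj₂ (refl , refl) = Graph.sym G Gab

    -ᴱ-singleEdge⁺ : ∀ {u v} → Adj G u v → ¬ EndPoints a b u v → Adj (G -ᴱ singleEdge) u v
    -ᴱ-singleEdge⁺ {u} Guv ¬uv = x∈p∧x∉q⇒x∈p─q Guv (¬uv ∘ singleEdge⁻ {u})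

    -- Every traversal of `ab` in a walk of `G`, in either direction, is replaced by the detour or
    -- its reverse.
    detour⇒connected : Connected G → Star (Adj (G -ᴱ singleEdge)) a b →
                       Connected (G -ᴱ singleEdge)
    detour⇒connected connected detour u v = kleisliStar id reroute (connected u v)
      where
      reroute : ∀ {x y} → Adj G x y → Star (Adj (G -ᴱ singleEdge)) x y
      reroute {x} {y} Gxy with endPoints? a b x y
      ... | no ¬xy                   = -ᴱ-singleEdge⁺ Gxy ¬xy ◅ ε
      ... | yes (inj₁ (refl , refl)) = detour
      ... | yes (inj₂ (refl , refl)) =
            reverse (λ {x} {y} → Graph.sym (G -ᴱ singleEdge) {x} {y}) detour

-- Dominating sets

Dominated : Graph n → Subset n → Pred (Fin n) _
Dominated G D v = v ∈ D ⊎ ∃[ u ] u ∈ D × Adj G v u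

dominated? : ∀ (G : Graph n) D → Decidable (Dominated G D)
dominated? G D v = v ∈? D ⊎-dec any? (λ u → u ∈? D ×-dec u ∈? N G v)

dominating? : ∀ (G : Graph n) → Decidable (Dominating G)
dominating? G D = all? (dominated? G D)

smallerDominating? : ∀ (G : Graph n) D → Dec (∃[ D′ ] D′ ⊂ D × Dominating G D′)
smallerDominating? G D = anySubset? (λ D′ → D′ ⊂? D ×-dec dominating? G D′)

mds? : ∀ (G : Graph n) → Decidable (MDS G)
mds? G D = dominating? G D ×-dec
  map′ (λ ¬smaller D′⊂D dom → ¬smaller (_ , D′⊂D , dom))
       (λ minimal → λ { (_ , D′⊂D , dom) → minimal D′⊂D dom })
       (¬? (smallerDominating? G D))

-- Pass to a strictly smaller dominating set as long as there is one; strict inclusion of finite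
-- subsets is well-founded.
MDS-below : ∀ (G : Graph n) {S} → Dominating G S → ∃[ D ] D ⊆ S × MDS G D
MDS-below G {S} dom = go dom (⊂-wellFounded S)
  where
  go : ∀ {S} → Dominating G S → Acc _⊂_ S → ∃[ D ] D ⊆ S × MDS G D
  go {S} dom (acc rec) with smallerDominating? G S
  ... | no  ¬smaller =
        S , ⊆-refl , dom , λ D′⊂S dom′ → ¬smaller (_ , D′⊂S , dom′)
  ... | yes (S′ , S′⊂S , dom′) with go dom′ (rec S′⊂S)
  ...   | D , D⊆S′ , mds = D , ⊆-trans D⊆S′ (p⊂q⇒p⊆q S′⊂S) , mds

Dominating-mono : ∀ {G : Graph n} {F D} → Dominating (G -ᴱ F) D → Dominating G D
Dominating-mono {G = G} {F} dom v =
  Sum.map₂ (λ (u , u∈D , H) → u , u∈D , -ᴱ-⊆ {G = G} F H) (dom v)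

-- Sputnik graphs are robust

sputnik⇒MDS-ᴱ : ∀ {G F : Graph n} {D} → Sputnik G → F ⊆ᴱ G → Connected (G -ᴱ F) →
                MDS G D → MDS (G -ᴱ F) D
sputnik⇒MDS-ᴱ {G = G} {F} {D} sputnik F⊆G connected (dom , minimal) =
  dom-ᴱ , λ D′⊂D dom′ → minimal D′⊂D (Dominating-mono {G = G} {F} dom′)
  where
  dom-ᴱ : Dominating (G -ᴱ F) D
  dom-ᴱ v with dom v
  ... | inj₁ v∈D = inj₁ v∈D
  ... | inj₂ (u , u∈D , Gvu) with u ∈? N F v
  ...   | no  ¬Fvu = inj₂ (u , u∈D , x∈p∧x∉q⇒x∈p─q Gvu ¬Fvu)
  ...   | yes Fvu with sputnik v (deletedEdge⇒OnCycle {G = G} {F} F⊆G connected Fvu)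
  ...     | a , Gva , deg≡1 with dom a
  -- The only neighbour of the antenna `a` is `v`, so a vertex of `D` dominating `a` from outside is
  -- `v` itself.
  ...       | inj₂ (w , w∈D , Gaw) =
                inj₁ (subst (_∈ D) (∣p∣≡1⇒subsingleton deg≡1 (Graph.sym G Gva) Gaw) w∈D)
  -- The first edge of a walk from `a` to `v` in `G -ᴱ F` can only lead to `v`; hence `av` survives
  -- and `a` dominates `v`.
  ...       | inj₁ a∈D with connected a v
  ...         | ε = contradiction Gva (Graph.irrefl G)
  ...         | _◅_ {j = x} Hax _
                  with refl ← ∣p∣≡1⇒subsingleton deg≡1 (Graph.sym G Gva) (-ᴱ-⊆ {G = G} F Hax) =
                  inj₂ (a , a∈D , Graph.sym (G -ᴱ F) Hax)

-- Robust graphs are sputnik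

Outside : Graph n → Fin n → Fin n → Pred (Fin n) _
Outside G a b x = x ≡ b ⊎ (x ≢ a × x ∉ N G a)

outside? : ∀ (G : Graph n) a b → Decidable (Outside G a b)
outside? G a b x = x ≟ b ⊎-dec (¬? (x ≟ a) ×-dec ¬? (x ∈? N G a))

-- V ∖ (N[a] ∖ {b})
outside : Graph n → Fin n → Fin n → Subset n
outside G a b = ⟪ outside? G a b ⟫

Adj⇒≢ : ∀ (G : Graph n) {u v} → Adj G u v → u ≢ v
Adj⇒≢ G Guv refl = Graph.irrefl G Guv

module _ {k : ℕ ⁺} (1≤k : [ 1 ] ≤⁺ k) {G : Graph n} (robust : 𝓤-MDS k G) where

  -- Otherwise a minimal dominating set inside `outside G a b` avoids `a` and every neighbour of `a`
  -- except `b`. Deleting `ab` then leaves `a` undominated, while the detour keeps the graph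
  -- connected, against robustness.
  outside-notDominating : ∀ {a b} (Gab : Adj G a b) →
    Star (Adj (G -ᴱ singleEdge a b (Adj⇒≢ G Gab))) a b →
    ¬ Dominating G (outside G a b)
  outside-notDominating {a} {b} Gab detour dom with MDS-below G dom
  ... | D , D⊆ , mds with proj₂ robust D mds F (singleEdge-⊆ᴱ a b a≢b G Gab)
                            (≤⁺-trans ℕₚ.≤-trans [ length-edges-singleEdge a b a≢b ] 1≤k)
    where
    a≢b = Adj⇒≢ G Gab
    F   = singleEdge a b a≢b
  ...   | inj₁ ¬connected =
          ¬connected (detour⇒connected a b (Adj⇒≢ G Gab) G (proj₁ robust) detour)
  ...   | inj₂ (dom-ᴱ , _) = undominated (dom-ᴱ a)
    where
    a≢b = Adj⇒≢ G Gab
    F   = singleEdge a b a≢b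

    undominated : ¬ Dominated (G -ᴱ F) D a
    undominated (inj₁ a∈D) with ∈⟪⟫⁻ (outside? G a b) (D⊆ a∈D)
    ... | inj₁ a≡b       = a≢b a≡b
    ... | inj₂ (a≢a , _) = a≢a refl
    undominated (inj₂ (u , u∈D , Hau)) with ∈⟪⟫⁻ (outside? G a b) (D⊆ u∈D)
    ... | inj₁ refl      = -ᴱ-∉ {G = G} F Hau (singleEdge⁺ a b a≢b)
    ... | inj₂ (_ , u∉)  = u∉ (-ᴱ-⊆ {G = G} F Hau)

  -- A second neighbour `z` of `w` would be adjacent to `v` too, so `w z v` is a detour for the edge
  -- `wv`. All of N[w] lies in N[v], so `v` alone dominates what `outside G w v` omits,
  -- contradicting `outside-notDominating` for `wv`.
  closedNbhd⊈ : ∀ {v w} → Adj G v w → degree G w ≢ 1 →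
                ¬ (∀ {y} → Adj G w y → y ≢ v → Adj G v y)
  closedNbhd⊈ {v} {w} Gvw deg≢1 N[w]⊆N[v]
    with any? (λ z → z ∈? N G w ×-dec ¬? (z ≟ v))
  ... | no ¬∃ = deg≢1 (subsingleton⇒∣p∣≡1 (Graph.sym G Gvw)
          λ {y} Gwy → decidable-stable (y ≟ v) λ y≢v → ¬∃ (y , Gwy , y≢v))
  ... | yes (z , Gwz , z≢v) = outside-notDominating Gwv (w⇝z ◅ z⇝v ◅ ε) dom
    where
    Gwv = Graph.sym G Gvw
    w≢v = Adj⇒≢ G Gwv
    F   = singleEdge w v w≢v

    w⇝z : Adj (G -ᴱ F) w z
    w⇝z = -ᴱ-singleEdge⁺ w v w≢v G Gwz
      λ { (inj₁ (_ , z≡v)) → z≢v z≡v ; (inj₂ (w≡v , _)) → w≢v w≡v }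

    z⇝v : Adj (G -ᴱ F) z v
    z⇝v = -ᴱ-singleEdge⁺ w v w≢v G (Graph.sym G (N[w]⊆N[v] Gwz z≢v))
      λ { (inj₁ (z≡w , _)) → Adj⇒≢ G Gwz (sym z≡w) ; (inj₂ (z≡v , _)) → z≢v z≡v }

    v∈outside : v ∈ outside G w v
    v∈outside = ∈⟪⟫⁺ (outside? G w v) (inj₁ refl)

    dom : Dominating G (outside G w v)
    dom y with y ≟ v | y ≟ w | y ∈? N G w
    ... | yes refl | _        | _       = inj₁ v∈outside
    ... | no  _    | yes refl | _       = inj₂ (v , v∈outside , Gwv)
    ... | no  y≢v  | no  _    | yes Gwy =
          inj₂ (v , v∈outside , Graph.sym G (N[w]⊆N[v] Gwy y≢v))
    ... | no  _    | no  y≢w  | no  y∉  =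
          inj₁ (∈⟪⟫⁺ (outside? G w v) (inj₂ (y≢w , y∉)))

  robust⇒sputnik : Sputnik G
  robust⇒sputnik v onCycle with any? (λ a → a ∈? N G v ×-dec degree G a ℕₚ.≟ 1)
  ... | yes antenna  = antenna
  ... | no  ¬antenna = ⊥-elim (impossible (OnCycle⇒IsCycle-∷ onCycle))
    where
    impossible : ¬ (∃[ vs ] IsCycle G (v ∷ vs))
    impossible ([]     , cycle (s≤s ()) _ _)
    impossible (_ ∷ [] , cycle (s≤s (s≤s ())) _ _)
    impossible (u ∷ x ∷ vs , cycle _ ((v≢u ∷ v∉) ∷ (u∉ ∷ _)) (Gvu ∷ linked)) =
      outside-notDominating Gvu detour dom
      where
      F = singleEdge v u (Adj⇒≢ G Gvu)

      -- An edge that starts at neither `u` nor `v` is not the deleted one. On the walk along the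
      -- rest of the cycle `v` occurs only as the last target, so every step qualifies.
      step : ∀ {y z} → u ≢ y → v ≢ y → Adj G y z → Adj (G -ᴱ F) y z
      step u≢y v≢y Gyz = -ᴱ-singleEdge⁺ v u (Adj⇒≢ G Gvu) G Gyz
        λ { (inj₁ (y≡v , _)) → v≢y (sym y≡v) ; (inj₂ (y≡u , _)) → u≢y (sym y≡u) }

      walk : ∀ {y} ys → All (u ≢_) (y ∷ ys) → All (v ≢_) (y ∷ ys) →
             Linked (Adj G) (y ∷ ys ∷ʳ v) → Star (Adj (G -ᴱ F)) y v
      walk []       (u≢y ∷ _)  (v≢y ∷ _)  (Gyv ∷ _)      = step u≢y v≢y Gyv ◅ ε
      walk (_ ∷ ys) (u≢y ∷ u∉) (v≢y ∷ v∉) (Gyz ∷ linked) =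
        step u≢y v≢y Gyz ◅ walk ys u∉ v∉ linked

      detour : Star (Adj (G -ᴱ F)) v u
      detour = reverse (λ {x} {y} → Graph.sym (G -ᴱ F) {x} {y})
        -- The edge `ux` starts at `u` and is treated apart: it survives because `x` differs from
        -- `v`.
        (-ᴱ-singleEdge⁺ v u (Adj⇒≢ G Gvu) G (Linked.head linked)
           (λ { (inj₁ (u≡v , _)) → v≢u (sym u≡v)
              ; (inj₂ (_ , x≡v)) → All.head v∉ (sym x≡v) })
         ◅ walk vs u∉ v∉ (Linked.tail linked))

      dom : Dominating G (outside G v u)
      dom w with dominated? G (outside G v u) w
      -- An undominated `w` lies in N(v), since `v` is dominated by `u` and vertices outside N[v]
      -- belong to the set. No neighbour of `w` lies outside N[v] either, so N[w] is contained in
      -- N[v].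
      ... | yes dominated   = dominated
      ... | no  ¬dominated = ⊥-elim (closedNbhd⊈ Gvw ¬antenna-w N[w]⊆N[v])
        where
        Gvw : Adj G v w
        Gvw with w ∈? N G v | w ≟ v
        ... | yes Gvw | _        = Gvw
        ... | no  _   | yes refl = contradiction
          (inj₂ (u , ∈⟪⟫⁺ (outside? G v u) (inj₁ refl) , Gvu)) ¬dominated
        ... | no  w∉  | no  w≢v  = contradiction
          (inj₁ (∈⟪⟫⁺ (outside? G v u) (inj₂ (w≢v , w∉)))) ¬dominated

        ¬antenna-w : degree G w ≢ 1
        ¬antenna-w deg≡1 = ¬antenna (w , Gvw , deg≡1)

        N[w]⊆N[v] : ∀ {y} → Adj G w y → y ≢ v → Adj G v y
        N[w]⊆N[v] {y} Gwy y≢v with y ∈? N G v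
        ... | yes Gvy = Gvy
        ... | no  y∉  = contradiction
          (inj₂ (y , ∈⟪⟫⁺ (outside? G v u) (inj₂ (y≢v , y∉)) , Gwy)) ¬dominated

theorem8 : ∀ (k : ℕ ⁺) → [ 1 ] ≤⁺ k → ∀ (n : ℕ) (G : Graph n) →
    𝓤-MDS k G ⇔ (Connected G × Sputnik G)
theorem8 k 1≤k n G = mk⇔
  (λ robust → proj₁ robust , robust⇒sputnik 1≤k robust)
  λ (connected , sputnik) → connected , λ D mds F F⊆G _ → robust sputnik D mds F F⊆G
  where
  robust : Sputnik G → ∀ D → MDS G D → ∀ F → F ⊆ᴱ G →
           ¬ Connected (G -ᴱ F) ⊎ MDS (G -ᴱ F) D
  -- The disjunction is settled by deciding minimal domination; if it fails, connectedness of
  -- `G -ᴱ F` is refuted by `sputnik⇒MDS-ᴱ`.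
  robust sputnik D mds F F⊆G with mds? (G -ᴱ F) D
  ... | yes mds-ᴱ = inj₂ mds-ᴱ
  ... | no ¬mds-ᴱ = inj₁ λ connected → ¬mds-ᴱ (sputnik⇒MDS-ᴱ {G = G} {F} sputnik F⊆G connected mds)
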